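{- Fix an integer $d \geq 3$. Then, as $n \to \infty$, $$(1 - o_n(1))\, \frac{1}{4ed^2} \;\leq\; \frac{H_s(n, d)\, d!}{n^{d-1}} \;\leq\; \frac{d}{d-1}.$$
   Context: For a pure simplicial complex $C$, its facets are its top-dimensional faces and its ridges are its faces of codimension one. The dual graph $G(C)$ has the facets of $C$ as vertices, two facets being adjacent if they intersect in a ridge. $C$ is strongly connected if $G(C)$ is connected, and the combinatorial diameter of $C$ is the graph diameter of $G(C)$. $H_s(n,d)$ denotes the largest combinatorial diameter of a strongly connected, pure $(d-1)$-dimensional simplicial complex on $n$ vertices. Here $e$ is Euler's number and $o_n(1)$ denotes a quantity tending to $0$ as $n\to\infty$ (with $d$ fixed). -}

module Defs where

open import Data.Nat using (ℕ; zero; suc; _+_; _*_; _∸_; _^_; _≤_; _<_; _≥_; _!)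

open import Data.Fin using (Fin)
open import Data.Fin.Subset using (Subset; ∣_∣; _∩_) renaming (_∈_ to _∈ₛ_)
open import Data.List using (List)
open import Data.List.Membership.Propositional using (_∈_)
open import Data.List.Relation.Unary.Unique.Propositional using (Unique)
open import Data.Product using (Σ; ∃; _×_)
open import Relation.Binary.PropositionalEquality using (_≡_)

record PureComplex (n d : ℕ) : Set where
  field
    facets      : List (Subset n)
    facetSize   : ∀ {F} → F ∈ facets → ∣ F ∣ ≡ d
    distinct    : Unique facets
    allVertices : ∀ (v : Fin n) → ∃ λ F → F ∈ facets × v ∈ₛ F
open PureComplex public

Adjacent : ∀ {n} (d : ℕ) → Subset n → Subset n → Set
Adjacent d F G = ∣ F ∩ G ∣ ≡ d ∸ 1

data Walk {n d : ℕ} (C : PureComplex n d) : Subset n → Subset n → ℕ → Set where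
  here : ∀ {F} → Walk C F F 0
  step : ∀ {F G H k} → G ∈ facets C → Adjacent d F G → Walk C G H k →
         Walk C F H (suc k)

StronglyConnected : ∀ {n d} → PureComplex n d → Set
StronglyConnected C =
  ∀ {F G} → F ∈ facets C → G ∈ facets C → ∃ λ k → Walk C F G k

-- Upper bound  H_s(n,d) * d! / n^(d-1) ≤ d/(d-1): every strongly connected
-- pure (d-1)-complex on n vertices has combinatorial diameter D with
-- D * d! * (d-1) ≤ d * n^(d-1).
UpperBound : ℕ → ℕ → Set
UpperBound n d =
  (C : PureComplex n d) → StronglyConnected C →
  ∀ {F G} → F ∈ facets C → G ∈ facets C →
  ∃ λ k → Walk C F G k × k * (d !) * (d ∸ 1) ≤ d * n ^ (d ∸ 1)

-- Lower bound  H_s(n,d) * d! / n^(d-1) ≥ a / b: some strongly connected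
-- pure (d-1)-complex on n vertices has two facets at dual-graph distance D
-- with b * D * d! ≥ a * n^(d-1).
LowerBound : ℕ → ℕ → ℕ → ℕ → Set
LowerBound a b n d =
  Σ (PureComplex n d) λ C → StronglyConnected C ×
    ∃ λ F → ∃ λ G → F ∈ facets C × G ∈ facets C ×
      (∀ k → Walk C F G k → a * n ^ (d ∸ 1) ≤ b * k * (d !))

-- Rational a/b (b ≥ 1) lies below 1/(4 d² u_k), where
-- u_k = (1 + 1/k)^(k+1) is an upper approximation of e (u_k ↓ e).
-- Ranging over all k ≥ 1, these are exactly the positive rationals < 1/(4 e d²).
BelowInvFourEdSq : ℕ → ℕ → ℕ → ℕ → Set
BelowInvFourEdSq a b d k =
  4 * d * d * a * (suc k) ^ (suc k) < b * k ^ (suc k)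

{-# OPTIONS --safe #-}
module Submission where

-- Lower bound.  Read a word over the n vertices as the strip of facets given by its windows of
-- d consecutive letters.  If windows starting at least two letters apart never share a ridge,
-- the dual graph of the strip is a path.  Such words are found by Rosenfeld's counting method
-- (a replacement for the local lemma): with G m the number of admissible words of length m, one
-- shows G (m + 1) ≥ β G m, where β = n - ⌊n/(2d)⌋.  A new letter can only fail by repeating one
-- of the last 2d letters, or by making the newest window share a ridge with an earlier one; in
-- the latter case deleting the newest window leaves one of G (m + 1 - d) ≤ β^(1-d) G m words,
-- and at most m · d · n · d! words lose their newest window to the same one.  This works up to
-- length about n^(d-1) / (4 d² d!), so e only enters through e ≥ 2.  Vertices not yet used can
-- be put in front of the word freely.
--
-- Upper bound.  On an induced path with l edges in the dual graph each ridge lies in at most two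
-- facets, and then in consecutive ones.  Counting orderings of ridges gives
-- (l + 1) d! ≤ n^(d-1) + l (d-1)!.

open import Defs
open import Data.Nat hiding (∣_-_∣)
open import Data.Nat.Properties
open import Data.Nat.DivMod using (m/n*n≤m; m*n/n≡m; /-monoˡ-≤; m≡m%n+[m/n]*n; m%n<n)
open import Data.Nat.Induction using (<-rec)
open import Data.Nat.Tactic.RingSolver using (solve-∀)
open import Algebra.Properties.Semiring.Sum +-*-semiring
  using (sum; sum-cong-≗; ∑-distrib-+; ∑-comm; *-distribˡ-sum)
open import Data.Bool using (if_then_else_)
open import Data.Fin using (Fin; zero; suc)
open import Data.Fin.Subset using (Subset; inside; outside; ∣_∣; _∩_; _∪_; ⁅_⁆; ⊥; _-_; _⊆_)
  renaming (_∈_ to _∈ₛ_; _∉_ to _∉ₛ_)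
open import Data.Fin.Subset.Properties hiding (⊆-refl; ⊆-trans)
open import Data.List using (List; []; _∷_; _++_; length; take; drop; applyUpTo; allFin)
open import Data.List.Properties using (length-take; take-drop; drop-all; drop-drop; take-all; take-[])
open import Data.Vec using ([]; _∷_; here; there)
open import Data.List.Relation.Unary.All as All using (All; []; _∷_)
open import Data.List.Relation.Unary.All.Properties using (¬Any⇒All¬)
open import Data.List.Relation.Unary.Any using (Any; here; there; any?)
open import Data.List.Membership.Propositional using (_∈_)
open import Data.List.Membership.Propositional.Properties using (∈-applyUpTo⁺; ∈-applyUpTo⁻; ∈-allFin)
open import Data.List.Relation.Unary.Unique.Propositional.Properties using (applyUpTo⁺₁)
open import Data.Product using (Σ; ∃; _×_; _,_; proj₂)
open import Data.Sum using (_⊎_; inj₁; inj₂)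
open import Function using (_∘_)
open import Relation.Nullary using (Dec; yes; no; contradiction)
open import Relation.Binary.PropositionalEquality
  using (_≡_; _≢_; refl; sym; trans; cong; cong₂; subst; module ≡-Reasoning)

private
  variable
    n m k : ℕ

-- Sums over letters and over words of fixed length.

sum-mono : {f g : Fin n → ℕ} → (∀ x → f x ≤ g x) → sum f ≤ sum g
sum-mono {zero}  f≤g = z≤n
sum-mono {suc n} f≤g = +-mono-≤ (f≤g zero) (sum-mono (f≤g ∘ suc))

sum-const : ∀ n c → sum {n} (λ _ → c) ≡ n * c
sum-const zero    c = refl
sum-const (suc n) c = cong (c +_) (sum-const n c)

-- Words are counted by summing ℕ-valued weights over all n^m of them, so a union bound becomes a
-- pointwise inequality and a double count an exchange of sums.
∑ʷ : ℕ → (List (Fin n) → ℕ) → ℕ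
∑ʷ zero    f = f []
∑ʷ (suc m) f = sum λ x → ∑ʷ m λ w → f (x ∷ w)

∑ʷ-cong : ∀ m {f g : List (Fin n) → ℕ} → (∀ w → f w ≡ g w) → ∑ʷ m f ≡ ∑ʷ m g
∑ʷ-cong zero    f≡g = f≡g []
∑ʷ-cong (suc m) f≡g = sum-cong-≗ λ x → ∑ʷ-cong m (f≡g ∘ (x ∷_))

∑ʷ-mono : ∀ m {f g : List (Fin n) → ℕ} → (∀ w → length w ≡ m → f w ≤ g w) → ∑ʷ m f ≤ ∑ʷ m g
∑ʷ-mono zero    f≤g = f≤g [] refl
∑ʷ-mono (suc m) f≤g = sum-mono λ x → ∑ʷ-mono m λ w eq → f≤g (x ∷ w) (cong suc eq)

∑ʷ-+ : ∀ m (f g : List (Fin n) → ℕ) → ∑ʷ m (λ w → f w + g w) ≡ ∑ʷ m f + ∑ʷ m g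
∑ʷ-+ zero    f g = refl
∑ʷ-+ (suc m) f g = trans (sum-cong-≗ λ x → ∑ʷ-+ m (f ∘ (x ∷_)) (g ∘ (x ∷_)))
                         (∑-distrib-+ (λ x → ∑ʷ m (f ∘ (x ∷_))) (λ x → ∑ʷ m (g ∘ (x ∷_))))

∑ʷ-*ˡ : ∀ m c (f : List (Fin n) → ℕ) → ∑ʷ m (λ w → c * f w) ≡ c * ∑ʷ m f
∑ʷ-*ˡ zero    c f = refl
∑ʷ-*ˡ (suc m) c f = trans (sum-cong-≗ λ x → ∑ʷ-*ˡ m c (f ∘ (x ∷_)))
                          (sym (*-distribˡ-sum c (λ x → ∑ʷ m (f ∘ (x ∷_)))))

∑ʷ-const : ∀ m c → ∑ʷ {n} m (λ _ → c) ≡ n ^ m * c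
∑ʷ-const         zero    c = sym (+-identityʳ c)
∑ʷ-const {n = n} (suc m) c = begin
  sum {n} (λ _ → ∑ʷ {n} m λ _ → c)  ≡⟨ sum-cong-≗ {n} (λ _ → ∑ʷ-const {n} m c) ⟩
  sum {n} (λ _ → n ^ m * c)         ≡⟨ sum-const n _ ⟩
  n * (n ^ m * c)                   ≡⟨ *-assoc n (n ^ m) c ⟨
  n * n ^ m * c                     ∎
  where open ≡-Reasoning

∑ʷ-sum-comm : ∀ m (f : Fin k → List (Fin n) → ℕ) →
              ∑ʷ m (λ w → sum λ x → f x w) ≡ sum (λ x → ∑ʷ m (f x))
∑ʷ-sum-comm zero    f = refl
∑ʷ-sum-comm (suc m) f = trans (sum-cong-≗ λ y → ∑ʷ-sum-comm m λ x w → f x (y ∷ w))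
                              (∑-comm λ y x → ∑ʷ m λ w → f x (y ∷ w))

∑ʷ-comm : ∀ m k (f : List (Fin n) → List (Fin n) → ℕ) →
          ∑ʷ m (λ v → ∑ʷ k (f v)) ≡ ∑ʷ k (λ w → ∑ʷ m λ v → f v w)
∑ʷ-comm zero    k f = refl
∑ʷ-comm (suc m) k f = trans (sum-cong-≗ λ x → ∑ʷ-comm m k λ v → f (x ∷ v))
                            (sym (∑ʷ-sum-comm k λ x w → ∑ʷ m λ v → f (x ∷ v) w))

∑ʷ-++ : ∀ m k (f : List (Fin n) → ℕ) → ∑ʷ (m + k) f ≡ ∑ʷ m (λ v → ∑ʷ k λ w → f (v ++ w))
∑ʷ-++ zero    k f = refl
∑ʷ-++ (suc m) k f = sum-cong-≗ λ x → ∑ʷ-++ m k (f ∘ (x ∷_))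

sum-pos : (f : Fin n → ℕ) → 1 ≤ sum f → ∃ λ x → 1 ≤ f x
sum-pos {suc n} f pos with f zero in eq
... | suc _ = zero , subst (1 ≤_) (sym eq) (s≤s z≤n)
... | zero with x , fx ← sum-pos (f ∘ suc) pos = suc x , fx

-- Turns a positive count into an actual word; existence in the lower bound comes from here.
∑ʷ-pos : ∀ m (f : List (Fin n) → ℕ) → 1 ≤ ∑ʷ m f → ∃ λ w → length w ≡ m × 1 ≤ f w
∑ʷ-pos zero    f pos = [] , refl , pos
∑ʷ-pos (suc m) f pos
  with x , posₓ      ← sum-pos (λ x → ∑ʷ m (f ∘ (x ∷_))) pos
  with w , eq , posʷ ← ∑ʷ-pos m (f ∘ (x ∷_)) posₓ
  = x ∷ w , cong suc eq , posʷ

-- Counting repetition-free words and words one deletion away from them.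

χ : Subset n → Fin n → ℕ
χ (s ∷ p) zero    = if s then 1 else 0
χ (s ∷ p) (suc x) = χ p x

sum-χ : (p : Subset n) → sum (χ p) ≡ ∣ p ∣
sum-χ []            = refl
sum-χ (inside  ∷ p) = cong suc (sum-χ p)
sum-χ (outside ∷ p) = sum-χ p

χ-∈ : {x : Fin n} {p : Subset n} → x ∈ₛ p → χ p x ≡ 1
χ-∈ here        = refl
χ-∈ (there x∈p) = χ-∈ x∈p

χ-∉ : {x : Fin n} {p : Subset n} → x ∉ₛ p → χ p x ≡ 0
χ-∉ {x = zero}  {inside  ∷ p} x∉p = contradiction here x∉p
χ-∉ {x = zero}  {outside ∷ p} x∉p = refl
χ-∉ {x = suc x} {s ∷ p}       x∉p = χ-∉ (x∉p ∘ there)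

∣p-x∣ : {x : Fin n} {p : Subset n} → x ∈ₛ p → suc ∣ p - x ∣ ≡ ∣ p ∣
∣p-x∣ {p = inside  ∷ p} here        = cong (suc ∘ ∣_∣) (p─⊥≡p p)
∣p-x∣ {p = inside  ∷ p} (there x∈p) = cong suc (∣p-x∣ x∈p)
∣p-x∣ {p = outside ∷ p} (there x∈p) = ∣p-x∣ x∈p

∩-distrib-minus : (p q : Subset n) (x : Fin n) → (p ∩ q) - x ≡ (p - x) ∩ (q - x)
∩-distrib-minus (s ∷ p) (t ∷ q) zero    =
  cong (outside ∷_) (trans (p─⊥≡p (p ∩ q)) (sym (cong₂ _∩_ (p─⊥≡p p) (p─⊥≡p q))))
∩-distrib-minus (s ∷ p) (t ∷ q) (suc x) = cong (_ ∷_) (∩-distrib-minus p q x)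

-- 1 if w is a repetition-free word with all letters in p, and 0 otherwise.
injWord : Subset n → List (Fin n) → ℕ
injWord p []      = 1
injWord p (x ∷ w) = χ p x * injWord (p - x) w

-- Number of positions of w whose deletion leaves a repetition-free word in p.
nearWord : Subset n → List (Fin n) → ℕ
nearWord p []      = 0
nearWord p (x ∷ w) = χ p x * nearWord (p - x) w + injWord p w

-- The falling factorial s (s - 1) ... (s - k + 1). For k > s a factor 0 occurs before `pred`
-- truncates.
ff : ℕ → ℕ → ℕ
ff s zero    = 1
ff s (suc k) = s * ff (pred s) k

ff-! : ∀ s → ff s s ≡ s !
ff-! zero    = refl
ff-! (suc s) = cong (suc s *_) (ff-! s)

ff-!′ : ∀ s → ff (suc s) s ≡ suc s !
ff-!′ zero    = refl
ff-!′ (suc s) = cong (suc (suc s) *_) (ff-!′ s)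

ff-mono : ∀ k {s t} → s ≤ t → ff s k ≤ ff t k
ff-mono zero    s≤t = ≤-refl
ff-mono (suc k) s≤t = *-mono-≤ s≤t (ff-mono k (pred-mono-≤ s≤t))

-- Every term of the sum over the first letter is f (∣ p ∣ - 1), and ∣ p ∣ terms survive.
sum-over-letters : (p : Subset n) (g : Subset n → ℕ) (f : ℕ → ℕ) → (∀ q → g q ≡ f ∣ q ∣) →
                   sum (λ x → χ p x * g (p - x)) ≡ ∣ p ∣ * f (pred ∣ p ∣)
sum-over-letters p g f g≡f = begin
  sum (λ x → χ p x * g (p - x))        ≡⟨ sum-cong-≗ term ⟩
  sum (λ x → f (pred ∣ p ∣) * χ p x)   ≡⟨ *-distribˡ-sum (f (pred ∣ p ∣)) (χ p) ⟨
  f (pred ∣ p ∣) * sum (χ p)           ≡⟨ cong (f (pred ∣ p ∣) *_) (sum-χ p) ⟩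
  f (pred ∣ p ∣) * ∣ p ∣               ≡⟨ *-comm (f (pred ∣ p ∣)) ∣ p ∣ ⟩
  ∣ p ∣ * f (pred ∣ p ∣)               ∎
  where
  open ≡-Reasoning
  term : ∀ x → χ p x * g (p - x) ≡ f (pred ∣ p ∣) * χ p x
  term x with x ∈? p
  ... | yes x∈p rewrite χ-∈ x∈p | g≡f (p - x) | sym (∣p-x∣ x∈p) = *-comm 1 (f ∣ p - x ∣)
  ... | no  x∉p rewrite χ-∉ x∉p = sym (*-zeroʳ (f (pred ∣ p ∣)))

∑ʷ-injWord : ∀ k (p : Subset n) → ∑ʷ k (injWord p) ≡ ff ∣ p ∣ k
∑ʷ-injWord zero    p = refl
∑ʷ-injWord (suc k) p = trans
  (sum-cong-≗ λ x → ∑ʷ-*ˡ k (χ p x) (injWord (p - x)))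
  (sum-over-letters p (λ q → ∑ʷ k (injWord q)) (λ s → ff s k) (∑ʷ-injWord k))

-- Choose the deleted position in k + 1 ways, its letter freely in n ways, and a repetition-free
-- word of length k in p for the rest. The induction separates deletion of the first letter from
-- deletion of a later one.
∑ʷ-nearWord : ∀ k (p : Subset n) → ∑ʷ (suc k) (nearWord p) ≡ suc k * n * ff ∣ p ∣ k
∑ʷ-nearWord {n = n} k p = begin
  sum (λ x → ∑ʷ k λ w → χ p x * nearWord (p - x) w + injWord p w)
    ≡⟨ sum-cong-≗ (λ x → trans (∑ʷ-+ k _ (injWord p))
         (cong₂ _+_ (∑ʷ-*ˡ k (χ p x) (nearWord (p - x))) (∑ʷ-injWord k p))) ⟩
  sum (λ x → χ p x * ∑ʷ k (nearWord (p - x)) + F k)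
    ≡⟨ ∑-distrib-+ (λ x → χ p x * ∑ʷ k (nearWord (p - x))) _ ⟩
  sum (λ x → χ p x * ∑ʷ k (nearWord (p - x))) + sum {n} (λ _ → F k)
    ≡⟨ cong₂ _+_ (inner k) (sum-const n _) ⟩
  k * n * F k + n * F k
    ≡⟨ arith k n (F k) ⟩
  suc k * n * F k ∎
  where
  open ≡-Reasoning
  F : ℕ → ℕ
  F = ff ∣ p ∣
  arith : ∀ k n f → k * n * f + n * f ≡ suc k * n * f
  arith = solve-∀
  swap : ∀ s k n f → s * (suc k * n * f) ≡ suc k * n * (s * f)
  swap = solve-∀
  inner : ∀ k → sum (λ x → χ p x * ∑ʷ k (nearWord (p - x))) ≡ k * n * ff ∣ p ∣ k
  inner zero = trans (sum-cong-≗ λ x → *-zeroʳ (χ p x)) (trans (sum-const n 0) (*-zeroʳ n))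
  inner (suc k) = trans
    (sum-over-letters p (λ q → ∑ʷ (suc k) (nearWord q)) (λ s → suc k * n * ff s k) (∑ʷ-nearWord k))
    (swap ∣ p ∣ k n (ff (pred ∣ p ∣) k))

-- Admissible words and a recurrence for their number.

toSet : List (Fin n) → Subset n
toSet []      = ⊥
toSet (x ∷ w) = ⁅ x ⁆ ∪ toSet w

∣p∪q∣≤∣p∣+∣q∣ : (p q : Subset n) → ∣ p ∪ q ∣ ≤ ∣ p ∣ + ∣ q ∣
∣p∪q∣≤∣p∣+∣q∣ []            []            = z≤n
∣p∪q∣≤∣p∣+∣q∣ (inside  ∷ p) (inside  ∷ q) =
  s≤s (≤-trans (∣p∪q∣≤∣p∣+∣q∣ p q) (+-monoʳ-≤ ∣ p ∣ (n≤1+n ∣ q ∣)))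
∣p∪q∣≤∣p∣+∣q∣ (inside  ∷ p) (outside ∷ q) = s≤s (∣p∪q∣≤∣p∣+∣q∣ p q)
∣p∪q∣≤∣p∣+∣q∣ (outside ∷ p) (inside  ∷ q) =
  ≤-trans (s≤s (∣p∪q∣≤∣p∣+∣q∣ p q)) (≤-reflexive (sym (+-suc ∣ p ∣ ∣ q ∣)))
∣p∪q∣≤∣p∣+∣q∣ (outside ∷ p) (outside ∷ q) = ∣p∪q∣≤∣p∣+∣q∣ p q

∣⁅x⁆∪p∣≤ : (x : Fin n) (p : Subset n) → ∣ ⁅ x ⁆ ∪ p ∣ ≤ suc ∣ p ∣
∣⁅x⁆∪p∣≤ x p = subst (λ i → ∣ ⁅ x ⁆ ∪ p ∣ ≤ i + ∣ p ∣) (∣⁅x⁆∣≡1 x) (∣p∪q∣≤∣p∣+∣q∣ ⁅ x ⁆ p)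

∣toSet∣≤length : (w : List (Fin n)) → ∣ toSet w ∣ ≤ length w
∣toSet∣≤length {n} [] = ≤-reflexive (∣⊥∣≡0 n)
∣toSet∣≤length (x ∷ w) = ≤-trans (∣⁅x⁆∪p∣≤ x (toSet w)) (s≤s (∣toSet∣≤length w))

∣toSet-take∣≤ : ∀ k (w : List (Fin n)) → ∣ toSet (take k w) ∣ ≤ k
∣toSet-take∣≤ k w = ≤-trans (∣toSet∣≤length (take k w))
  (≤-trans (≤-reflexive (length-take k w)) (m⊓n≤m k (length w)))

take-++-length : ∀ {A : Set} (v w : List A) → take (length v) (v ++ w) ≡ v
take-++-length []      w = refl
take-++-length (x ∷ v) w = cong (x ∷_) (take-++-length v w)

drop-++-length : ∀ {A : Set} (v w : List A) → drop (length v) (v ++ w) ≡ w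
drop-++-length []      w = refl
drop-++-length (x ∷ v) w = drop-++-length v w

-- A positive `nearWord` expresses that `h` meets a window in at least a ridge, in a form that can
-- be summed over `h`. Suffixes shorter than d count as windows too, which only strengthens the
-- demand that no conflict occurs.
conflicts : ℕ → List (Fin n) → List (Fin n) → ℕ
conflicts d h []          = 0
conflicts d h w@(_ ∷ w′) = nearWord (toSet (take d w)) h + conflicts d h w′

-- The head of a word is its newest letter.  Requiring a new letter to differ from the last 2d
-- letters, and not only from the last d, also keeps overlapping windows from sharing a ridge.
defect : ℕ → List (Fin n) → ℕ
defect d []      = 0
defect d (x ∷ w) =
  defect d w + χ (toSet (take (2 * d) w)) x + conflicts d (take d (x ∷ w)) (drop (pred d) w)

isZero : ℕ → ℕ
isZero zero    = 1
isZero (suc _) = 0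

isZero-antitone : ∀ {a b} → a ≤ b → isZero b ≤ isZero a
isZero-antitone {zero}  {zero}  a≤b = ≤-refl
isZero-antitone {zero}  {suc b} a≤b = z≤n
isZero-antitone {suc a} {suc b} a≤b = z≤n

-- The union bound for one extension: `a` is the old defect, `b` the repetition of a recent letter,
-- `c` the conflicts of the new window.
isZero-+ : ∀ a b c → isZero a ≤ isZero (a + b + c) + isZero a * b + isZero a * c
isZero-+ zero    zero    zero    = ≤-refl
isZero-+ zero    zero    (suc c) = s≤s z≤n
isZero-+ zero    (suc b) c       = s≤s z≤n
isZero-+ (suc a) b       c       = z≤n

isZero-pos : ∀ {a} → 1 ≤ isZero a → a ≡ 0
isZero-pos {zero} _ = refl

defect-++ : ∀ d (v w : List (Fin n)) → defect d w ≤ defect d (v ++ w)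
defect-++ d []      w = ≤-refl
defect-++ d (x ∷ v) w = ≤-trans (defect-++ d v w) (≤-trans (m≤m+n _ _) (m≤m+n _ _))

goodWords : ℕ → ℕ → ℕ → ℕ
goodWords n d m = ∑ʷ {n} m (isZero ∘ defect d)

-- Each suffix of `v` contributes one window with at most k + 1 letters, so `∑ʷ-nearWord` applies to
-- it with falling factorial at most (k + 1)!.
∑ʷ-conflicts : ∀ k (v : List (Fin n)) →
               ∑ʷ (suc k) (λ h → conflicts (suc k) h v) ≤ length v * (suc k * n * suc k !)
∑ʷ-conflicts {n} k []          =
  ≤-reflexive (trans (∑ʷ-const {n} (suc k) 0) (*-zeroʳ (n ^ suc k)))
∑ʷ-conflicts {n} k v@(_ ∷ v′) = begin
  ∑ʷ (suc k) (λ h → conflicts (suc k) h v)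
    ≡⟨ ∑ʷ-+ (suc k) (nearWord p) (λ h → conflicts (suc k) h v′) ⟩
  ∑ʷ (suc k) (nearWord p) + ∑ʷ (suc k) (λ h → conflicts (suc k) h v′)
    ≤⟨ +-mono-≤ first (∑ʷ-conflicts k v′) ⟩
  suc k * n * suc k ! + length v′ * (suc k * n * suc k !)  ∎
  where
  open ≤-Reasoning
  p = toSet (take (suc k) v)
  first : ∑ʷ (suc k) (nearWord p) ≤ suc k * n * suc k !
  first = begin
    ∑ʷ (suc k) (nearWord p)   ≡⟨ ∑ʷ-nearWord k p ⟩
    suc k * n * ff (∣ p ∣) k  ≤⟨ *-monoʳ-≤ (suc k * n) (ff-mono k (∣toSet-take∣≤ (suc k) v)) ⟩
    suc k * n * ff (suc k) k  ≡⟨ cong (suc k * n *_) (ff-!′ k) ⟩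
    suc k * n * suc k !       ∎

-- An extension u = h ++ v of a good word is charged to v, which is good, and for fixed v the
-- conflicts of the window h are counted by ∑ʷ-conflicts.
∑ʷ-extension-conflicts : ∀ n k m →
  ∑ʷ {n} (suc m) (λ u → isZero (defect (suc k) (drop 1 u)) *
                        conflicts (suc k) (take (suc k) u) (drop (suc k) u))
    ≤ (m ∸ k) * (suc k * n * suc k !) * goodWords n (suc k) (m ∸ k)
∑ʷ-extension-conflicts n k m with k ≤? m
... | no k≰m = begin
  ∑ʷ {n} (suc m) T          ≤⟨ ∑ʷ-mono (suc m) vanish ⟩
  ∑ʷ {n} (suc m) (λ _ → 0)  ≡⟨ ∑ʷ-const {n} (suc m) 0 ⟩
  n ^ suc m * 0             ≡⟨ *-zeroʳ (n ^ suc m) ⟩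
  0                         ≤⟨ z≤n ⟩
  (m ∸ k) * (suc k * n * suc k !) * goodWords n (suc k) (m ∸ k) ∎
  where
  open ≤-Reasoning
  T : List (Fin n) → ℕ
  T u = isZero (defect (suc k) (drop 1 u)) * conflicts (suc k) (take (suc k) u) (drop (suc k) u)
  vanish : ∀ u → length u ≡ suc m → T u ≤ 0
  vanish u eq rewrite drop-all (suc k) u (subst (_≤ suc k) (sym eq) (≰⇒≥ (k≰m ∘ s≤s⁻¹))) =
    ≤-reflexive (*-zeroʳ (isZero (defect (suc k) (drop 1 u))))
... | yes k≤m = begin
  ∑ʷ {n} (suc m) T
    ≡⟨ cong (λ i → ∑ʷ {n} (suc i) T) (m+[n∸m]≡n k≤m) ⟨
  ∑ʷ {n} (suc k + m′) T
    ≡⟨ ∑ʷ-++ {n} (suc k) m′ T ⟩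
  ∑ʷ {n} (suc k) (λ h → ∑ʷ {n} m′ λ v → T (h ++ v))
    ≤⟨ ∑ʷ-mono (suc k) (λ h eq → ∑ʷ-mono m′ λ v _ → bound h v eq) ⟩
  ∑ʷ {n} (suc k) (λ h → ∑ʷ {n} m′ λ v → isZero (defect (suc k) v) * conflicts (suc k) h v)
    ≡⟨ ∑ʷ-comm (suc k) m′ (λ h v → isZero (defect (suc k) v) * conflicts (suc k) h v) ⟩
  ∑ʷ {n} m′ (λ v → ∑ʷ {n} (suc k) λ h → isZero (defect (suc k) v) * conflicts (suc k) h v)
    ≡⟨ ∑ʷ-cong m′ (λ v → ∑ʷ-*ˡ (suc k) (isZero (defect (suc k) v)) (λ h → conflicts (suc k) h v)) ⟩
  ∑ʷ {n} m′ (λ v → isZero (defect (suc k) v) * ∑ʷ {n} (suc k) λ h → conflicts (suc k) h v)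
    ≤⟨ ∑ʷ-mono m′ bound′ ⟩
  ∑ʷ {n} m′ (λ v → m′ * C * isZero (defect (suc k) v))
    ≡⟨ ∑ʷ-*ˡ {n} m′ (m′ * C) (isZero ∘ defect (suc k)) ⟩
  m′ * C * goodWords n (suc k) m′ ∎
  where
  open ≤-Reasoning
  m′ = m ∸ k
  C  = suc k * n * suc k !
  T : List (Fin n) → ℕ
  T u = isZero (defect (suc k) (drop 1 u)) * conflicts (suc k) (take (suc k) u) (drop (suc k) u)
  bound : ∀ h v → length h ≡ suc k →
          T (h ++ v) ≤ isZero (defect (suc k) v) * conflicts (suc k) h v
  bound (x ∷ h) v refl rewrite take-++-length h v | drop-++-length h v =
    *-monoˡ-≤ (conflicts (suc k) (x ∷ h) v) (isZero-antitone (defect-++ (suc k) h v))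
  bound′ : ∀ v → length v ≡ m′ →
           isZero (defect (suc k) v) * ∑ʷ {n} (suc k) (λ h → conflicts (suc k) h v)
             ≤ m′ * C * isZero (defect (suc k) v)
  bound′ v eq = begin
    isZero (defect (suc k) v) * ∑ʷ {n} (suc k) (λ h → conflicts (suc k) h v)
      ≤⟨ *-monoʳ-≤ (isZero (defect (suc k) v)) (∑ʷ-conflicts k v) ⟩
    isZero (defect (suc k) v) * (length v * C)
      ≤⟨ *-monoʳ-≤ (isZero (defect (suc k) v))
           (≤-reflexive (cong (_* C) eq)) ⟩
    isZero (defect (suc k) v) * (m′ * C)
      ≡⟨ *-comm (isZero (defect (suc k) v)) (m′ * C) ⟩
    m′ * C * isZero (defect (suc k) v) ∎

-- Sums `isZero-+` over all one-letter extensions of words of length m. A good word loses at most 2d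
-- extensions to recent letters; the conflict term is `∑ʷ-extension-conflicts`.
goodWords-step : ∀ n k m →
  n * goodWords n (suc k) m
    ≤ goodWords n (suc k) (suc m) + 2 * suc k * goodWords n (suc k) m
      + (m ∸ k) * (suc k * n * suc k !) * goodWords n (suc k) (m ∸ k)
goodWords-step n k m = begin
  n * G m
    ≡⟨ sum-const n (G m) ⟨
  sum {n} (λ _ → G m)
    ≤⟨ sum-mono {n} (λ x → ∑ʷ-mono m λ w _ → isZero-+ (defect d w) (χ (rec w) x) (conf x w)) ⟩
  ∑ʷ {n} (suc m) (λ u → isZero (defect d u) + A u + B u)
    ≡⟨ ∑ʷ-+ (suc m) (λ u → isZero (defect d u) + A u) B ⟩
  ∑ʷ {n} (suc m) (λ u → isZero (defect d u) + A u) + ∑ʷ {n} (suc m) B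
    ≡⟨ cong (_+ ∑ʷ (suc m) B) (∑ʷ-+ (suc m) (isZero ∘ defect d) A) ⟩
  G (suc m) + ∑ʷ {n} (suc m) A + ∑ʷ {n} (suc m) B
    ≤⟨ +-mono-≤ (+-monoʳ-≤ (G (suc m)) boundA) (∑ʷ-extension-conflicts n k m) ⟩
  G (suc m) + 2 * d * G m + (m ∸ k) * (d * n * d !) * G (m ∸ k) ∎
  where
  open ≤-Reasoning
  d = suc k
  G = goodWords n d
  rec : List (Fin n) → Subset n
  rec w = toSet (take (2 * d) w)
  conf : Fin n → List (Fin n) → ℕ
  conf x w = conflicts d (take d (x ∷ w)) (drop k w)
  A B : List (Fin n) → ℕ
  A []      = 0
  A (x ∷ w) = isZero (defect d w) * χ (rec w) x
  -- On `x ∷ w` this reduces to `isZero (defect d w) * conf x w`, because `drop d (x ∷ w)` is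
  -- `drop k w`.
  B u = isZero (defect d (drop 1 u)) * conflicts d (take d u) (drop d u)
  boundA : ∑ʷ {n} (suc m) A ≤ 2 * d * G m
  boundA = begin
    ∑ʷ {n} (suc m) A
      ≡⟨ ∑ʷ-sum-comm m (λ x w → A (x ∷ w)) ⟨
    ∑ʷ {n} m (λ w → sum λ x → isZero (defect d w) * χ (rec w) x)
      ≡⟨ ∑ʷ-cong m (λ w → trans (sym (*-distribˡ-sum (isZero (defect d w)) (χ (rec w))))
                                (cong (isZero (defect d w) *_) (sum-χ (rec w)))) ⟩
    ∑ʷ {n} m (λ w → isZero (defect d w) * ∣ rec w ∣)
      ≤⟨ ∑ʷ-mono m (λ w _ → ≤-trans
           (*-monoʳ-≤ (isZero (defect d w)) (∣toSet-take∣≤ (2 * d) w))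
           (≤-reflexive (*-comm (isZero (defect d w)) (2 * d)))) ⟩
    ∑ʷ {n} m (λ w → 2 * d * isZero (defect d w))
      ≡⟨ ∑ʷ-*ˡ m (2 * d) (isZero ∘ defect d) ⟩
    2 * d * G m ∎

-- Exponential growth of the number of admissible words.

-- The n choices for a new letter are budgeted: 2d for recent letters, s for conflicts, β for
-- growth. `M-bound` says that up to length M the conflicts stay within their share.
module _ (n k s β M : ℕ) (n≡ : n ≡ β + (s + 2 * suc k))
         (M-bound : M * (suc k * n * suc k !) ≤ s * β ^ k) where

  private
    d = suc k
    C = d * n * d !
    G = goodWords n d

  iterate-growth : ∀ m j → (∀ {i} → i < m + j → β * G i ≤ G (suc i)) → β ^ j * G m ≤ G (m + j)
  iterate-growth m zero    _    =
    ≤-reflexive (trans (+-identityʳ (G m)) (cong G (sym (+-identityʳ m))))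
  iterate-growth m (suc j) grow = begin
    β * β ^ j * G m    ≡⟨ *-assoc β (β ^ j) (G m) ⟩
    β * (β ^ j * G m)  ≤⟨ *-monoʳ-≤ β (iterate-growth m j λ i<m+j →
                            grow (<-≤-trans i<m+j (+-monoʳ-≤ m (n≤1+n j)))) ⟩
    β * G (m + j)      ≤⟨ grow (+-monoʳ-< m (n<1+n j)) ⟩
    G (suc (m + j))    ≡⟨ cong G (+-suc m j) ⟨
    G (m + suc j)      ∎
    where open ≤-Reasoning

  -- The k growth steps before m give β^k G (m - k) ≤ G m, so by `M-bound` conflicts cost at most s
  -- · G m extensions. Taking these and the 2d · G m recent repetitions from n · G m leaves β · G m.
  growth : ∀ m → m ≤ M → β * G m ≤ G (suc m)
  growth = <-rec (λ m → m ≤ M → β * G m ≤ G (suc m)) λ m rec m≤M →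
    +-cancelʳ-≤ ((s + 2 * d) * G m) _ _ (begin
      β * G m + (s + 2 * d) * G m
        ≡⟨ *-distribʳ-+ (G m) β (s + 2 * d) ⟨
      (β + (s + 2 * d)) * G m
        ≡⟨ cong (_* G m) n≡ ⟨
      n * G m
        ≤⟨ goodWords-step n k m ⟩
      G (suc m) + 2 * d * G m + (m ∸ k) * C * G (m ∸ k)
        ≤⟨ +-monoʳ-≤ (G (suc m) + 2 * d * G m) (conflictBound m m≤M
             λ {i} i<m → rec i<m (≤-trans (<⇒≤ i<m) m≤M)) ⟩
      G (suc m) + 2 * d * G m + s * G m
        ≡⟨ regroup (G (suc m)) (2 * d) s (G m) ⟩
      G (suc m) + (s + 2 * d) * G m ∎)
    where
    open ≤-Reasoning
    regroup : ∀ g a b c → g + a * c + b * c ≡ g + (b + a) * c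
    regroup = solve-∀
    conflictBound : ∀ m → m ≤ M → (∀ {i} → i < m → β * G i ≤ G (suc i)) →
                    (m ∸ k) * C * G (m ∸ k) ≤ s * G m
    conflictBound m m≤M grow with k ≤? m
    ... | no k≰m rewrite m≤n⇒m∸n≡0 (≰⇒≥ k≰m) = z≤n
    ... | yes k≤m = begin
      (m ∸ k) * C * G (m ∸ k)    ≤⟨ *-monoˡ-≤ (G (m ∸ k))
                                      (≤-trans (*-monoˡ-≤ C (≤-trans (m∸n≤m m k) m≤M)) M-bound) ⟩
      s * β ^ k * G (m ∸ k)      ≡⟨ *-assoc s (β ^ k) (G (m ∸ k)) ⟩
      s * (β ^ k * G (m ∸ k))    ≤⟨ *-monoʳ-≤ s (iterate-growth (m ∸ k) k λ {i} i<m →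
                                      grow (subst (i <_) (m∸n+n≡m k≤m) i<m)) ⟩
      s * G (m ∸ k + k)          ≡⟨ cong (λ i → s * G i) (m∸n+n≡m k≤m) ⟩
      s * G m                    ∎

  goodWords-positive : 1 ≤ β → 1 ≤ G M
  goodWords-positive 1≤β = begin
    1                ≡⟨ ^-zeroˡ M ⟨
    1 ^ M            ≤⟨ ^-monoˡ-≤ M 1≤β ⟩
    -- `G 0` reduces to 1, since the empty word has defect 0.
    β ^ M            ≡⟨ *-identityʳ (β ^ M) ⟨
    β ^ M * G 0      ≤⟨ iterate-growth 0 M (λ i<M → growth _ (<⇒≤ i<M)) ⟩
    G M              ∎
    where open ≤-Reasoning

  exists-goodWord : 1 ≤ β → ∃ λ w → length w ≡ M × defect {n} d w ≡ 0
  exists-goodWord 1≤β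
    with w , eq , pos ← ∑ʷ-pos M (isZero ∘ defect d) (goodWords-positive 1≤β)
    = w , eq , isZero-pos pos

-- Numerical estimates and the choice of parameters.

-- Bernoulli's inequality (1 - t/N)^j ≥ 1 - jt/N for N = β + t, multiplied by N^(j+1) to avoid
-- division and subtraction.
bernoulli : ∀ β t j → (β + t) * (β + t) ^ j ≤ (β + t) * β ^ j + j * t * (β + t) ^ j
bernoulli β t zero    = m≤m+n _ 0
bernoulli β t (suc j) = begin
  (β + t) * ((β + t) * (β + t) ^ j)
    ≤⟨ *-monoʳ-≤ (β + t) (bernoulli β t j) ⟩
  (β + t) * ((β + t) * β ^ j + j * t * (β + t) ^ j)
    ≡⟨ expand β t j (β ^ j) ((β + t) ^ j) ⟩
  (β + t) * (β * β ^ j) + t * ((β + t) * β ^ j) + j * t * ((β + t) * (β + t) ^ j)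
    ≤⟨ +-monoˡ-≤ _ (+-monoʳ-≤ ((β + t) * (β * β ^ j))
         (*-monoʳ-≤ t (*-monoʳ-≤ (β + t) (^-monoˡ-≤ j (m≤m+n β t))))) ⟩
  (β + t) * (β * β ^ j) + t * ((β + t) * (β + t) ^ j) + j * t * ((β + t) * (β + t) ^ j)
    ≡⟨ collect ((β + t) * (β * β ^ j)) t j ((β + t) * (β + t) ^ j) ⟩
  (β + t) * (β * β ^ j) + suc j * t * ((β + t) * (β + t) ^ j) ∎
  where
  open ≤-Reasoning
  expand : ∀ β t j b c → (β + t) * ((β + t) * b + j * t * c)
           ≡ (β + t) * (β * b) + t * ((β + t) * b) + j * t * ((β + t) * c)
  expand = solve-∀
  collect : ∀ a t j c → a + t * c + j * t * c ≡ a + suc j * t * c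
  collect = solve-∀

^≤2*^ : ∀ β t j → 1 ≤ β + t → 2 * (j * t) ≤ β + t → (β + t) ^ j ≤ 2 * β ^ j
^≤2*^ β t j pos 2jt≤N = *-cancelˡ-≤ N {{>-nonZero pos}} (+-cancelʳ-≤ (N * N ^ j) _ _ (begin
  N * N ^ j + N * N ^ j                    ≡⟨ double (N * N ^ j) ⟨
  2 * (N * N ^ j)                          ≤⟨ *-monoʳ-≤ 2 (bernoulli β t j) ⟩
  2 * (N * β ^ j + j * t * N ^ j)          ≡⟨ distr N (β ^ j) (j * t) (N ^ j) ⟩
  N * (2 * β ^ j) + 2 * (j * t) * N ^ j    ≤⟨ +-monoʳ-≤ (N * (2 * β ^ j)) (*-monoˡ-≤ (N ^ j) 2jt≤N) ⟩
  N * (2 * β ^ j) + N * N ^ j              ∎))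
  where
  open ≤-Reasoning
  N = β + t
  double : ∀ a → 2 * a ≡ a + a
  double = solve-∀
  distr : ∀ N b c p → 2 * (N * b + c * p) ≡ N * (2 * b) + 2 * c * p
  distr = solve-∀

m<[1+m/n]*n : ∀ m n .{{_ : NonZero n}} → m < suc (m / n) * n
m<[1+m/n]*n m n = begin-strict
  m                    ≡⟨ m≡m%n+[m/n]*n m n ⟩
  m % n + m / n * n    <⟨ +-monoˡ-< (m / n * n) (m%n<n m n) ⟩
  n + m / n * n        ∎
  where open ≤-Reasoning

-- Since `BelowInvFourEdSq⇒≤` gives a/b ≤ 1/(8 d²), distance n^k / D suffices. In the threshold for
-- n, `suc d * D` pays for rounding the path length up and for the d further letters that the word
-- has; the other terms pay for the floor in `t` and the 2d recent letters.
module LongWord (k n D : ℕ) (1≤k : 1 ≤ k) (D≡ : D ≡ 8 * suc k * suc k * suc k !)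
                (N≤n : suc (suc k) * D + (4 * suc k + 8 * suc k * suc k) ≤ n) where

  private
    d = suc k

    instance
      D≢0 : NonZero D
      D≢0 = subst NonZero (sym D≡) (m*n≢0 (8 * d * d) (d !) {{_}} {{d !≢0}})

  pathLength : ℕ
  pathLength = suc (n ^ k / D)

  pathLength-lower : n ^ k ≤ pathLength * D
  pathLength-lower = <⇒≤ (m<[1+m/n]*n (n ^ k) D)

  pathLength-upper : (pathLength + d) * D ≤ n ^ k + suc d * D
  pathLength-upper = begin
    (suc (n ^ k / D) + d) * D    ≡⟨ regroup (n ^ k / D) d D ⟩
    n ^ k / D * D + suc d * D    ≤⟨ +-monoˡ-≤ (suc d * D) (m/n*n≤m (n ^ k) D) ⟩
    n ^ k + suc d * D            ∎
    where
    open ≤-Reasoning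
    regroup : ∀ q d D → (suc q + d) * D ≡ q * D + suc d * D
    regroup = solve-∀

  longGoodWord : ∃ λ w → length w ≡ pathLength + d × defect {n} d w ≡ 0
  longGoodWord = exists-goodWord n k s β M n≡ M-bound 1≤β
    where
    open ≤-Reasoning
    t s β M : ℕ
    -- Giving up t letters per step, about n/(2d), keeps β^k ≥ n^k / 2 by `^≤2*^`; of these t, 2d
    -- are recent letters and s remain for conflicts.
    t = n / (2 * d)
    s = t ∸ 2 * d
    β = n ∸ t
    M = pathLength + d

    2dt≤n : 2 * d * t ≤ n
    2dt≤n = ≤-trans (≤-reflexive (*-comm (2 * d) t)) (m/n*n≤m n (2 * d))

    n≤2dt+2d : n ≤ 2 * d * t + 2 * d
    n≤2dt+2d = ≤-trans (<⇒≤ (m<[1+m/n]*n n (2 * d))) (≤-reflexive (rearr t (2 * d)))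
      where
      rearr : ∀ t e → suc t * e ≡ e * t + e
      rearr = solve-∀

    2d≤t : 2 * d ≤ t
    2d≤t = begin
      2 * d                    ≡⟨ m*n/n≡m (2 * d) (2 * d) ⟨
      2 * d * (2 * d) / (2 * d)  ≤⟨ /-monoˡ-≤ (2 * d) 4dd≤n ⟩
      n / (2 * d)              ∎
      where
      split : ∀ d → 8 * d * d ≡ 2 * d * (2 * d) + 4 * d * d
      split = solve-∀
      4dd≤n : 2 * d * (2 * d) ≤ n
      4dd≤n = begin
        2 * d * (2 * d)              ≤⟨ m≤m+n _ (4 * d * d) ⟩
        2 * d * (2 * d) + 4 * d * d  ≡⟨ split d ⟨
        8 * d * d                    ≤⟨ m≤n+m _ (4 * d) ⟩
        4 * d + 8 * d * d            ≤⟨ m≤n+m _ (suc d * D) ⟩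
        suc d * D + (4 * d + 8 * d * d) ≤⟨ N≤n ⟩
        n                            ∎

    1≤t : 1 ≤ t
    1≤t = ≤-trans (s≤s z≤n) 2d≤t

    t+t≤n : t + t ≤ n
    t+t≤n = begin
      t + t            ≡⟨ dbl t ⟩
      2 * t            ≤⟨ *-monoˡ-≤ t (m≤m*n 2 d) ⟩
      2 * d * t        ≤⟨ 2dt≤n ⟩
      n                ∎
      where
      dbl : ∀ t → t + t ≡ 2 * t
      dbl = solve-∀

    t≤n : t ≤ n
    t≤n = ≤-trans (m≤m+n t t) t+t≤n

    1≤β : 1 ≤ β
    1≤β = ≤-trans 1≤t (subst (_≤ β) (m+n∸n≡m t t) (∸-monoˡ-≤ t t+t≤n))

    β+t≡n : β + t ≡ n
    β+t≡n = m∸n+n≡m t≤n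

    n≡ : n ≡ β + (s + 2 * d)
    n≡ = trans (sym β+t≡n) (cong (β +_) (sym (m∸n+n≡m 2d≤t)))

    1≤n : 1 ≤ n
    1≤n = ≤-trans 1≤t t≤n

    n^k≤2β^k : n ^ k ≤ 2 * β ^ k
    n^k≤2β^k = subst (λ i → i ^ k ≤ 2 * β ^ k) β+t≡n
      (^≤2*^ β t k (subst (1 ≤_) (sym β+t≡n) 1≤n) (subst (2 * (k * t) ≤_) (sym β+t≡n) (begin
        2 * (k * t)  ≤⟨ *-monoʳ-≤ 2 (*-monoˡ-≤ t (n≤1+n k)) ⟩
        2 * (d * t)  ≡⟨ *-assoc 2 d t ⟨
        2 * d * t    ≤⟨ 2dt≤n ⟩
        n            ∎)))

    2n≤4ds : 2 * n ≤ 4 * d * s + (4 * d + 8 * d * d)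
    2n≤4ds = begin
      2 * n                               ≤⟨ *-monoʳ-≤ 2 n≤2dt+2d ⟩
      2 * (2 * d * t + 2 * d)             ≡⟨ cong (λ i → 2 * (2 * d * i + 2 * d)) (m∸n+n≡m 2d≤t) ⟨
      2 * (2 * d * (s + 2 * d) + 2 * d)   ≡⟨ expand d s ⟩
      4 * d * s + (4 * d + 8 * d * d)     ∎
      where
      expand : ∀ d s → 2 * (2 * d * (s + 2 * d) + 2 * d) ≡ 4 * d * s + (4 * d + 8 * d * d)
      expand = solve-∀

    -- 1/(8 d²) is half of the density 1/(4 d²) that the growth rate β = n (1 - 1/(2d)) allows.
    room : (n ^ k + suc d * D) * n ≤ 4 * d * s * n ^ k
    room = +-cancelʳ-≤ ((4 * d + 8 * d * d) * n ^ k) _ _ (begin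
      (n ^ k + suc d * D) * n + E * n ^ k
        ≡⟨ r₁ (n ^ k) (suc d * D) n E ⟩
      n * n ^ k + suc d * D * n + E * n ^ k
        ≤⟨ +-monoˡ-≤ (E * n ^ k) (+-monoʳ-≤ (n * n ^ k) (*-monoʳ-≤ (suc d * D) n≤n^k)) ⟩
      n * n ^ k + suc d * D * n ^ k + E * n ^ k
        ≡⟨ r₂ (n * n ^ k) (suc d * D) E (n ^ k) ⟩
      n * n ^ k + (suc d * D + E) * n ^ k
        ≤⟨ +-monoʳ-≤ (n * n ^ k) (*-monoˡ-≤ (n ^ k) N≤n) ⟩
      n * n ^ k + n * n ^ k
        ≡⟨ r₃ n (n ^ k) ⟩
      2 * n * n ^ k
        ≤⟨ *-monoˡ-≤ (n ^ k) 2n≤4ds ⟩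
      (4 * d * s + E) * n ^ k
        ≡⟨ *-distribʳ-+ (n ^ k) (4 * d * s) E ⟩
      4 * d * s * n ^ k + E * n ^ k ∎)
      where
      E = 4 * d + 8 * d * d
      n≤n^k : n ≤ n ^ k
      n≤n^k = subst (_≤ n ^ k) (*-identityʳ n) (^-monoʳ-≤ n {{>-nonZero 1≤n}} 1≤k)
      r₁ : ∀ p c n e → (p + c) * n + e * p ≡ n * p + c * n + e * p
      r₁ = solve-∀
      r₂ : ∀ a c e p → a + c * p + e * p ≡ a + (c + e) * p
      r₂ = solve-∀
      r₃ : ∀ n p → n * p + n * p ≡ 2 * n * p
      r₃ = solve-∀

    M-bound : M * (d * n * d !) ≤ s * β ^ k
    -- The factor 8d completes d · n · d! to D · n.
    M-bound = *-cancelˡ-≤ (8 * d) (begin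
      8 * d * (M * (d * n * d !))    ≡⟨ q₁ M d n (d !) ⟩
      M * (8 * d * d * d !) * n      ≡⟨ cong (λ i → M * i * n) D≡ ⟨
      M * D * n                      ≤⟨ *-monoˡ-≤ n pathLength-upper ⟩
      (n ^ k + suc d * D) * n        ≤⟨ room ⟩
      4 * d * s * n ^ k              ≤⟨ *-monoʳ-≤ (4 * d * s) n^k≤2β^k ⟩
      4 * d * s * (2 * β ^ k)        ≡⟨ q₂ d s (β ^ k) ⟩
      8 * d * (s * β ^ k)            ∎)
      where
      q₁ : ∀ M d n f → 8 * d * (M * (d * n * f)) ≡ M * (8 * d * d * f) * n
      q₁ = solve-∀
      q₂ : ∀ d s b → 4 * d * s * (2 * b) ≡ 8 * d * (s * b)
      q₂ = solve-∀

-- From admissible words to words whose windows meet only as intended.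

toSet-take-mono : ∀ {j k} (w : List (Fin n)) → j ≤ k → toSet (take j w) ⊆ toSet (take k w)
toSet-take-mono {j = zero}             w       j≤k = ⊥⊆
toSet-take-mono {j = suc j} {suc k} []      j≤k = λ x∈ → x∈
toSet-take-mono {j = suc j} {suc k} (x ∷ w) j≤k y∈
  with x∈p∪q⁻ ⁅ x ⁆ (toSet (take j w)) y∈
... | inj₁ y∈x = x∈p∪q⁺ (inj₁ y∈x)
... | inj₂ y∈w = x∈p∪q⁺ (inj₂ (toSet-take-mono w (s≤s⁻¹ j≤k) y∈w))

toSet-take-⊆ : ∀ k (w : List (Fin n)) → toSet (take k w) ⊆ toSet w
toSet-take-⊆ zero    w       = ⊥⊆
toSet-take-⊆ (suc k) []      = λ x∈ → x∈
toSet-take-⊆ (suc k) (x ∷ w) y∈ with x∈p∪q⁻ ⁅ x ⁆ (toSet (take k w)) y∈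
... | inj₁ y∈x = x∈p∪q⁺ (inj₁ y∈x)
... | inj₂ y∈w = x∈p∪q⁺ (inj₂ (toSet-take-⊆ k w y∈w))

toSet-drop-⊆ : ∀ i (w : List (Fin n)) → toSet (drop i w) ⊆ toSet w
toSet-drop-⊆ zero    w       = λ x∈ → x∈
toSet-drop-⊆ (suc i) []      = λ x∈ → x∈
toSet-drop-⊆ (suc i) (x ∷ w) = λ y∈ → x∈p∪q⁺ (inj₂ (toSet-drop-⊆ i w y∈))

toSet-take-drop-⊆ : ∀ i k (w : List (Fin n)) → toSet (take k (drop i w)) ⊆ toSet (take (i + k) w)
toSet-take-drop-⊆ i k w rewrite take-drop k i w = toSet-drop-⊆ i (take (i + k) w)

∪∩-∉ : {x : Fin n} (q : Subset n) {p : Subset n} → x ∉ₛ p → (⁅ x ⁆ ∪ q) ∩ p ⊆ q ∩ p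
∪∩-∉ {x = x} q {p} x∉p y∈ with x∈p∩q⁻ (⁅ x ⁆ ∪ q) p y∈
... | y∈∪ , y∈p with x∈p∪q⁻ ⁅ x ⁆ q y∈∪
...   | inj₁ y∈x = contradiction (subst (_∈ₛ p) (x∈⁅y⁆⇒x≡y x y∈x) y∈p) x∉p
...   | inj₂ y∈q = x∈p∩q⁺ (y∈q , y∈p)

∪∩-∈ : (x : Fin n) (q p : Subset n) → (⁅ x ⁆ ∪ q) ∩ p ⊆ ⁅ x ⁆ ∪ (q ∩ (p - x))
∪∩-∈ x q p {y} y∈ with x∈p∩q⁻ (⁅ x ⁆ ∪ q) p y∈
... | y∈∪ , y∈p with x∈p∪q⁻ ⁅ x ⁆ q y∈∪ | y ∈? ⁅ x ⁆
...   | inj₁ y∈x | _       = x∈p∪q⁺ (inj₁ y∈x)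
...   | inj₂ _   | yes y∈x = x∈p∪q⁺ (inj₁ y∈x)
...   | inj₂ y∈q | no  y∉x = x∈p∪q⁺ (inj₂ (x∈p∩q⁺ (y∈q , x∈p∧x≢y⇒x∈p-y y∈p (x∉⁅y⁆⇒x≢y y∉x))))

∣∪∩∣-∈ : (x : Fin n) (q p : Subset n) → ∣ (⁅ x ⁆ ∪ q) ∩ p ∣ ≤ suc ∣ q ∩ (p - x) ∣
∣∪∩∣-∈ x q p = ≤-trans (p⊆q⇒∣p∣≤∣q∣ (∪∩-∈ x q p)) (∣⁅x⁆∪p∣≤ x (q ∩ (p - x)))

∣⁅x⁆∪p∣≥ : {x : Fin n} {p : Subset n} → x ∉ₛ p → suc ∣ p ∣ ≤ ∣ ⁅ x ⁆ ∪ p ∣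
∣⁅x⁆∪p∣≥ {x = x} {p} x∉p =
  p⊂q⇒∣p∣<∣q∣ (q⊆p∪q ⁅ x ⁆ p , x , x∈p∪q⁺ (inj₁ (x∈⁅x⁆ x)) , x∉p)

-- Some letter of `h` lies outside `p` or repeats an earlier one, and that position adds nothing to
-- the intersection.
injWord≡0⇒∣∩∣< : (p : Subset n) (h : List (Fin n)) → injWord p h ≡ 0 → ∣ toSet h ∩ p ∣ < length h
injWord≡0⇒∣∩∣< p (x ∷ h) eq with x ∈? p
... | yes x∈p = s≤s (≤-trans (∣∪∩∣-∈ x (toSet h) p) (injWord≡0⇒∣∩∣< (p - x) h eq′))
  where
  eq′ : injWord (p - x) h ≡ 0
  eq′ = trans (sym (*-identityˡ _)) (trans (cong (_* injWord (p - x) h) (sym (χ-∈ x∈p))) eq)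
... | no x∉p = s≤s (≤-trans (p⊆q⇒∣p∣≤∣q∣ (∪∩-∉ (toSet h) x∉p))
                     (≤-trans (∣p∩q∣≤∣p∣ (toSet h) p) (∣toSet∣≤length h)))

-- Otherwise all positions but at most one would carry distinct letters of `p`, and deleting the
-- exceptional one would be counted by `nearWord`.
nearWord≡0⇒∣∩∣< : (p : Subset n) (x : Fin n) (h : List (Fin n)) → nearWord p (x ∷ h) ≡ 0 →
                  ∣ toSet (x ∷ h) ∩ p ∣ < length h
nearWord≡0⇒∣∩∣< p x h eq with x ∈? p | m+n≡0⇒n≡0 (χ p x * nearWord (p - x) h) eq
... | no  x∉p | inj≡0 =
  ≤-trans (s≤s (p⊆q⇒∣p∣≤∣q∣ (∪∩-∉ (toSet h) x∉p))) (injWord≡0⇒∣∩∣< p h inj≡0)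
-- An empty `h` is impossible here: `injWord p []` is 1, so the second matched proof would show 1 ≡
-- 0.
nearWord≡0⇒∣∩∣< p x (y ∷ h) eq | yes x∈p | _ =
  s≤s (≤-trans (∣∪∩∣-∈ x (toSet (y ∷ h)) p) (nearWord≡0⇒∣∩∣< (p - x) y h eq′))
  where
  eq′ : nearWord (p - x) (y ∷ h) ≡ 0
  eq′ = trans (sym (*-identityˡ _))
    (trans (cong (_* nearWord (p - x) (y ∷ h)) (sym (χ-∈ x∈p))) (m+n≡0⇒m≡0 _ eq))

conflicts≡0 : ∀ d (h v : List (Fin n)) → conflicts d h v ≡ 0 → ∀ i →
              drop i v ≡ [] ⊎ nearWord (toSet (take d (drop i v))) h ≡ 0
conflicts≡0 d h []      eq zero    = inj₁ refl
conflicts≡0 d h []      eq (suc i) = inj₁ refl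
conflicts≡0 d h (y ∷ v) eq zero    = inj₂ (m+n≡0⇒m≡0 _ eq)
conflicts≡0 d h (y ∷ v) eq (suc i) =
  conflicts≡0 d h v (m+n≡0⇒n≡0 (nearWord (toSet (take d (y ∷ v))) h) eq) i

-- The offset `suc i` skips the window one letter away, which does share a ridge. Avoiding d
-- previous letters, not d - 1, makes that window a different set.
data Separated (d : ℕ) {n : ℕ} : List (Fin n) → Set where
  []  : Separated d []
  add : ∀ {x w} → x ∉ₛ toSet (take d w) →
        (∀ i → ∣ toSet (take d (x ∷ w)) ∩ toSet (take d (drop (suc i) w)) ∣ < pred d) →
        Separated d w → Separated d (x ∷ w)

∣∩toSet-take[]∣ : ∀ d (q : Subset n) {w : List (Fin n)} → w ≡ [] → ∣ q ∩ toSet (take d w) ∣ ≤ 0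
∣∩toSet-take[]∣ {n} d q refl =
  ≤-trans (∣p∩q∣≤∣q∣ q (toSet (take d [])))
          (≤-reflexive (trans (cong (∣_∣ ∘ toSet {n}) (take-[] d)) (∣⊥∣≡0 n)))

-- Two windows that start at least two letters apart miss a ridge as soon as the two newest
-- letters of the later one do not occur in the earlier one.
∣∩∣<-by-two-letters : ∀ e {x y : Fin n} w {p} → x ∉ₛ p → y ∉ₛ p →
                      ∣ toSet (x ∷ y ∷ take e w) ∩ p ∣ < suc e
∣∩∣<-by-two-letters e {x} {y} w {p} x∉p y∉p = s≤s (begin
  ∣ (⁅ x ⁆ ∪ (⁅ y ⁆ ∪ u)) ∩ p ∣   ≤⟨ p⊆q⇒∣p∣≤∣q∣ (∪∩-∉ (⁅ y ⁆ ∪ u) x∉p) ⟩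
  ∣ (⁅ y ⁆ ∪ u) ∩ p ∣             ≤⟨ p⊆q⇒∣p∣≤∣q∣ (∪∩-∉ u y∉p) ⟩
  ∣ u ∩ p ∣                       ≤⟨ ∣p∩q∣≤∣p∣ u p ⟩
  ∣ u ∣                           ≤⟨ ∣toSet-take∣≤ e w ⟩
  e                               ∎)
  where
  open ≤-Reasoning
  u = toSet (take e w)

χ≡0⇒∉ : {x : Fin n} {p : Subset n} → χ p x ≡ 0 → x ∉ₛ p
χ≡0⇒∉ eq x∈p with () ← trans (sym eq) (χ-∈ x∈p)

-- An older window starting i + 2 letters away overlaps the newest one when i < e. It then lies
-- within the last 2d letters, so the two newest letters both miss it. For i ≥ e the vanishing
-- conflicts apply.
defect≡0⇒Separated : ∀ e (w : List (Fin n)) → defect (2 + e) w ≡ 0 → Separated (2 + e) w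
defect≡0⇒Separated e []      eq = []
defect≡0⇒Separated {n} e (x ∷ w) eq =
  add (λ x∈ → x∉recent (toSet-take-mono w (m≤n*m d 2) x∈)) (far w x∉recent conf≡0 w≡0)
      (defect≡0⇒Separated e w w≡0)
  where
  d = 2 + e
  split : defect d w + χ (toSet (take (2 * d) w)) x ≡ 0
  split = m+n≡0⇒m≡0 _ eq
  w≡0 : defect d w ≡ 0
  w≡0 = m+n≡0⇒m≡0 _ split
  x∉recent : x ∉ₛ toSet (take (2 * d) w)
  x∉recent = χ≡0⇒∉ (m+n≡0⇒n≡0 (defect d w) split)
  conf≡0 : conflicts d (take d (x ∷ w)) (drop (suc e) w) ≡ 0
  conf≡0 = m+n≡0⇒n≡0 (defect d w + χ (toSet (take (2 * d) w)) x) eq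
  far : ∀ w → x ∉ₛ toSet (take (2 * d) w) → conflicts d (take d (x ∷ w)) (drop (suc e) w) ≡ 0 →
        defect d w ≡ 0 →
        ∀ i → ∣ toSet (take d (x ∷ w)) ∩ toSet (take d (drop (suc i) w)) ∣ < suc e
  far []      _ _ _ i = s≤s (≤-trans (∣∩toSet-take[]∣ d (toSet (take d (x ∷ []))) refl) z≤n)
  far (y ∷ w) x∉ conf≡0 y∷w≡0 i with i <? e
  ... | yes i<e = ∣∩∣<-by-two-letters e w
        (λ x∈ → x∉ (toSet-take-mono (y ∷ w) (i+d≤2d i<e)
                      (toSet-take-drop-⊆ (suc i) d (y ∷ w) x∈)))
        (λ y∈ → χ≡0⇒∉ (m+n≡0⇒n≡0 (defect d w) (m+n≡0⇒m≡0 _ y∷w≡0))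
                      (toSet-take-mono w (≤-trans (n≤1+n (i + d)) (i+d≤2d i<e))
                         (toSet-take-drop-⊆ i d w y∈)))
    where
    i+d≤2d : i < e → suc i + d ≤ 2 * d
    i+d≤2d i<e = +-mono-≤ (≤-trans i<e (m≤n+m e 2)) (≤-reflexive (sym (+-identityʳ d)))
  ... | no i≮e with i ∸ e | m+[n∸m]≡n (≮⇒≥ i≮e)
  ...   | i′ | refl with conflicts≡0 d (take d (x ∷ y ∷ w)) (drop e w) conf≡0 i′
  ...     | inj₁ empty =
            s≤s (≤-trans (∣∩toSet-take[]∣ d (toSet (take d (x ∷ y ∷ w)))
                            (trans (sym (drop-drop e i′ w)) empty)) z≤n)
  ...     | inj₂ near≡0 rewrite drop-drop e i′ w =
            ≤-trans (nearWord≡0⇒∣∩∣< _ x (take (suc e) (y ∷ w)) near≡0)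
              (≤-trans (≤-reflexive (length-take (suc e) (y ∷ w))) (m⊓n≤m (suc e) _))

-- A fresh letter is in no older window, so the bound is inherited from the window one letter older.
-- At distance two that window offers no bound, but its own newest letter misses the older window as
-- well.
Separated-fresh : ∀ e {x : Fin n} {w} → Separated (2 + e) w → x ∉ₛ toSet w → Separated (2 + e) (x ∷ w)
Separated-fresh e {x} {w} sep x∉w =
  add (λ x∈ → x∉w (toSet-take-⊆ (2 + e) w x∈)) (far sep x∉w) sep
  where
  d = 2 + e
  far : ∀ {w} → Separated d w → x ∉ₛ toSet w →
        ∀ i → ∣ toSet (take d (x ∷ w)) ∩ toSet (take d (drop (suc i) w)) ∣ < suc e
  far []                       _  i = s≤s (≤-trans (∣∩toSet-take[]∣ d (toSet (take d (x ∷ []))) refl) z≤n)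
  far (add {y} {w} y∉ _ _)     x∉ zero    =
    ∣∩∣<-by-two-letters e w (λ x∈ → x∉ (x∈p∪q⁺ (inj₂ (toSet-take-⊆ d w x∈)))) y∉
  far (add {y} {w} _ far-y _)  x∉ (suc i) =
    ≤-trans (s≤s (p⊆q⇒∣p∣≤∣q∣ step-⊆)) (far-y i)
    where
    p = toSet (take d (drop (suc i) w))
    x∉p : x ∉ₛ p
    x∉p x∈ = x∉ (x∈p∪q⁺ (inj₂ (toSet-drop-⊆ (suc i) w (toSet-take-⊆ d (drop (suc i) w) x∈))))
    step-⊆ : toSet (take d (x ∷ y ∷ w)) ∩ p ⊆ toSet (take d (y ∷ w)) ∩ p
    step-⊆ z∈ with x∈p∩q⁻ (toSet (take (suc e) (y ∷ w))) p
                     (∪∩-∉ (toSet (take (suc e) (y ∷ w))) x∉p z∈)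
    ... | z∈w , z∈p = x∈p∩q⁺ (toSet-take-mono (y ∷ w) (n≤1+n (suc e)) z∈w , z∈p)

-- The complex must use all n vertices. Missing ones are prepended one at a time, and the word only
-- gets longer.
cover : ∀ e (vs w : List (Fin n)) → Separated (2 + e) w →
        ∃ λ w′ → Separated (2 + e) w′ × length w ≤ length w′ × toSet w ⊆ toSet w′ ×
                 (∀ {v} → v ∈ vs → v ∈ₛ toSet w′)
cover e []       w sep = w , sep , ≤-refl , (λ x∈ → x∈) , λ ()
cover e (v ∷ vs) w sep with v ∈? toSet w
... | yes v∈w with w′ , sep′ , len , sub , all ← cover e vs w sep =
  w′ , sep′ , len , sub , λ { (here refl) → sub v∈w ; (there u∈) → all u∈ }
... | no v∉w with w′ , sep′ , len , sub , all ← cover e vs (v ∷ w) (Separated-fresh e sep v∉w) =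
  w′ , sep′ , ≤-trans (n≤1+n _) len , (λ x∈ → sub (x∈p∪q⁺ (inj₂ x∈))) ,
  λ { (here refl) → sub (x∈p∪q⁺ (inj₁ (x∈⁅x⁆ v))) ; (there u∈) → all u∈ }

-- Windows of a separated word and the strip complex.

∣toSet-take∣ : ∀ d {k} {w : List (Fin n)} → Separated d w → k ≤ suc d → k ≤ length w →
               ∣ toSet (take k w) ∣ ≡ k
∣toSet-take∣ {n} d {zero}        sep           _       _   = ∣⊥∣≡0 n
∣toSet-take∣     d {suc k} (add {x} {w} x∉ _ sep) k<d+1 k< =
  ≤-antisym (∣toSet-take∣≤ (suc k) (x ∷ w))
    (subst (λ i → suc i ≤ ∣ toSet (take (suc k) (x ∷ w)) ∣)
       (∣toSet-take∣ d sep (≤-trans (n≤1+n k) k<d+1) (s≤s⁻¹ k<))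
       (∣⁅x⁆∪p∣≥ λ x∈ → x∉ (toSet-take-mono w (s≤s⁻¹ k<d+1) x∈)))

window : ℕ → List (Fin n) → ℕ → Subset n
window d w i = toSet (take d (drop i w))

∣window∣ : ∀ d {w : List (Fin n)} → Separated d w → ∀ i → i + d ≤ length w → ∣ window d w i ∣ ≡ d
∣window∣ d sep           zero    len = ∣toSet-take∣ d sep (n≤1+n d) len
∣window∣ d (add _ _ sep) (suc i) len = ∣window∣ d sep i (s≤s⁻¹ len)

∣window∩next∣ : ∀ e {w : List (Fin n)} → Separated (2 + e) w → ∀ i → suc i + (2 + e) ≤ length w →
                ∣ window (2 + e) w i ∩ window (2 + e) w (suc i) ∣ ≡ suc e
∣window∩next∣ e (add _ _ sep) (suc i) len = ∣window∩next∣ e sep i (s≤s⁻¹ len)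
∣window∩next∣ e (add {x} {w} x∉ _ sep) zero len = ≤-antisym
  (≤-trans (p⊆q⇒∣p∣≤∣q∣ (∪∩-∉ ridge x∉))
    (≤-trans (∣p∩q∣≤∣p∣ ridge next) (∣toSet-take∣≤ (suc e) w)))
  (subst (_≤ ∣ (⁅ x ⁆ ∪ ridge) ∩ next ∣)
     (∣toSet-take∣ (2 + e) sep (m≤n+m (suc e) 2) (≤-trans (n≤1+n (suc e)) (s≤s⁻¹ len)))
     (p⊆q⇒∣p∣≤∣q∣ ridge⊆∩))
  where
  ridge = toSet (take (suc e) w)
  next  = toSet (take (2 + e) w)
  ridge⊆∩ : ridge ⊆ (⁅ x ⁆ ∪ ridge) ∩ next
  ridge⊆∩ y∈ = x∈p∩q⁺ (x∈p∪q⁺ (inj₂ y∈) , toSet-take-mono w (n≤1+n (suc e)) y∈)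

∣window∩far∣ : ∀ e {w : List (Fin n)} → Separated (2 + e) w → ∀ i j →
               ∣ window (2 + e) w i ∩ window (2 + e) w (2 + i + j) ∣ < suc e
∣window∩far∣ e []            i       j =
  s≤s (≤-trans (∣∩toSet-take[]∣ (2 + e) (window (2 + e) [] i) refl) z≤n)
∣window∩far∣ e (add _ far _) zero    j = far j
∣window∩far∣ e (add _ _ sep) (suc i) j = ∣window∩far∣ e sep i j

window-cover : ∀ d (w : List (Fin n)) → d ≤ length w → 1 ≤ d → ∀ v → v ∈ₛ toSet w →
               ∃ λ i → i + d ≤ length w × v ∈ₛ window d w i
window-cover d []      d≤ 1≤d v v∈ = contradiction v∈ ∉⊥
window-cover (suc d) (x ∷ w) d≤ 1≤d v v∈ with suc d ≤? length w | x∈p∪q⁻ ⁅ x ⁆ (toSet w) v∈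
... | yes _   | inj₁ v∈x = 0 , d≤ , x∈p∪q⁺ (inj₁ v∈x)
... | yes d≤w | inj₂ v∈w with i , len , v∈i ← window-cover (suc d) w d≤w 1≤d v v∈w = suc i , s≤s len , v∈i
... | no  d≰w | _ = 0 , d≤ ,
  subst (λ u → v ∈ₛ toSet u) (sym (take-all (suc d) (x ∷ w) (≰⇒> d≰w))) v∈

walk-++ : ∀ {d} {C : PureComplex n d} {F G H k l} → Walk C F G k → Walk C G H l → Walk C F H (k + l)
walk-++ here              q = q
walk-++ (step G∈ adj p) q = step G∈ adj (walk-++ p q)

-- A word of L + d letters has L + 1 windows, so L counts the edges of the path.
module Strip (e : ℕ) {n : ℕ} (w : List (Fin n)) (sep : Separated (2 + e) w)
             (L : ℕ) (len : length w ≡ L + (2 + e)) (all : ∀ v → v ∈ₛ toSet w) where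

  private
    d = 2 + e

  W : ℕ → Subset n
  W = window d w

  fits : ∀ {i} → i ≤ L → i + d ≤ length w
  fits {i} i≤L = subst (i + d ≤_) (sym len) (+-monoˡ-≤ d i≤L)

  ∣W∣ : ∀ {i} → i ≤ L → ∣ W i ∣ ≡ d
  ∣W∣ {i} i≤L = ∣window∣ d sep i (fits i≤L)

  adjacent-next : ∀ {i} → suc i ≤ L → Adjacent d (W i) (W (suc i))
  adjacent-next {i} i<L = ∣window∩next∣ e sep i (fits i<L)

  ∣W∩far∣ : ∀ {i j} → suc i < j → ∣ W i ∩ W j ∣ < suc e
  ∣W∩far∣ {i} {j} 1+i<j =
    subst (λ l → ∣ W i ∩ W l ∣ < suc e) (m+[n∸m]≡n 1+i<j) (∣window∩far∣ e sep i (j ∸ (2 + i)))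

  -- Equal windows would meet in d elements, but consecutive ones meet in d - 1 and farther ones in
  -- fewer.
  W-distinct : ∀ {i j} → i < j → j ≤ L → W i ≢ W j
  W-distinct {i} {j} i<j j≤L eq with ∣W∩W∣≡d ← trans (cong (λ q → ∣ W i ∩ q ∣) (sym eq))
                                                   (trans (cong ∣_∣ (∩-idem (W i))) (∣W∣ (≤-trans (<⇒≤ i<j) j≤L)))
                                   | m≤n⇒m<n∨m≡n i<j
  ... | inj₁ 1+i<j = <⇒≢ (<-trans (∣W∩far∣ 1+i<j) (n<1+n (suc e))) ∣W∩W∣≡d
  ... | inj₂ refl  = <⇒≢ (n<1+n (suc e)) (trans (sym (adjacent-next j≤L)) ∣W∩W∣≡d)

  facets⁻ : ∀ {F} → F ∈ applyUpTo W (suc L) → ∃ λ i → i ≤ L × F ≡ W i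
  facets⁻ F∈ with i , i<1+L , eq ← ∈-applyUpTo⁻ W F∈ = i , s≤s⁻¹ i<1+L , eq

  facets⁺ : ∀ {i} → i ≤ L → W i ∈ applyUpTo W (suc L)
  facets⁺ i≤L = ∈-applyUpTo⁺ W (s≤s i≤L)

  strip : PureComplex n d
  strip .facets = applyUpTo W (suc L)
  strip .facetSize F∈ with i , i≤L , refl ← facets⁻ F∈ = ∣W∣ i≤L
  strip .distinct = applyUpTo⁺₁ W (suc L) λ i<j j<1+L → W-distinct i<j (s≤s⁻¹ j<1+L)
  strip .allVertices v
    with i , i+d≤ , v∈ ← window-cover d w (subst (d ≤_) (sym len) (m≤n+m d L)) (s≤s z≤n) v (all v)
    = W i , facets⁺ (+-cancelʳ-≤ d i L (subst (i + d ≤_) len i+d≤)) , v∈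

  walk-up : ∀ i k → i + k ≤ L → Walk strip (W i) (W (i + k)) k
  walk-up i zero    _     = subst (λ j → Walk strip (W i) (W j) 0) (sym (+-identityʳ i)) here
  walk-up i (suc k) i+k<L rewrite +-suc i k =
    step (facets⁺ (≤-trans (s≤s (m≤m+n i k)) i+k<L))
         (adjacent-next (≤-trans (s≤s (m≤m+n i k)) i+k<L))
         (walk-up (suc i) k i+k<L)

  walk-down : ∀ i → i ≤ L → Walk strip (W i) (W 0) i
  walk-down zero    _   = here
  walk-down (suc i) i<L =
    step (facets⁺ (<⇒≤ i<L)) (trans (cong ∣_∣ (∩-comm (W (suc i)) (W i))) (adjacent-next i<L))
         (walk-down i (<⇒≤ i<L))

  stronglyConnected : StronglyConnected strip
  stronglyConnected F∈ G∈ with i , i≤L , refl ← facets⁻ F∈ | j , j≤L , refl ← facets⁻ G∈ =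
    i + j , walk-++ (walk-down i i≤L) (walk-up 0 j j≤L)

  -- A step raises the window index by at most one, as windows farther ahead share no ridge.
  -- Endpoints are given by equations so that the walk can be matched on.
  walk-length : ∀ {i F G k} → i ≤ L → F ≡ W i → G ≡ W L → Walk strip F G k → L ≤ i + k
  walk-length {i} i≤L refl eq here with m≤n⇒m<n∨m≡n i≤L
  ... | inj₁ i<L  = contradiction eq (W-distinct i<L ≤-refl)
  ... | inj₂ refl = m≤m+n i 0
  walk-length {i} {k = suc k} i≤L refl eq (step G∈ adj p)
    with j , j≤L , refl ← facets⁻ G∈ =
    ≤-trans (walk-length j≤L refl eq p)
      (≤-trans (+-monoˡ-≤ k j≤1+i) (≤-reflexive (sym (+-suc i k))))
    where
    j≤1+i : j ≤ suc i
    j≤1+i with j ≤? suc i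
    ... | yes j≤ = j≤
    ... | no  j≰ = contradiction adj (<⇒≢ (∣W∩far∣ (≰⇒> j≰)))

-- Assembly of the lower bound.

-- Only the estimate (1 + 1/k)^(k+1) ≥ 2 is needed.
BelowInvFourEdSq⇒≤ : ∀ a b d k → 1 ≤ k → BelowInvFourEdSq a b d k → 8 * d * d * a ≤ b
BelowInvFourEdSq⇒≤ a b d k 1≤k below = *-cancelʳ-≤ _ _ (k ^ suc k) {{m^n≢0 k (suc k) {{>-nonZero 1≤k}}}} (begin
  8 * d * d * a * k ^ suc k              ≡⟨ rearr d a (k ^ suc k) ⟩
  4 * d * d * a * (2 * k ^ suc k)        ≤⟨ *-monoʳ-≤ (4 * d * d * a) (2k^≤ k) ⟩
  4 * d * d * a * suc k ^ suc k          ≤⟨ <⇒≤ below ⟩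
  b * k ^ suc k                          ∎)
  where
  open ≤-Reasoning
  rearr : ∀ d a p → 8 * d * d * a * p ≡ 4 * d * d * a * (2 * p)
  rearr = solve-∀
  bern : ∀ k j → k ^ suc j + suc j * k ^ j ≤ suc k ^ suc j
  bern k zero    = ≤-reflexive (base k)
    where
    base : ∀ k → k * 1 + (1 + 0) ≡ suc k * 1
    base = solve-∀
  bern k (suc j) = begin
    k * (k * k ^ j) + (2 + j) * (k * k ^ j)
      ≤⟨ m≤m+n _ (suc j * k ^ j) ⟩
    k * (k * k ^ j) + (2 + j) * (k * k ^ j) + suc j * k ^ j
      ≡⟨ expand k j (k ^ j) ⟩
    suc k * (k * k ^ j + suc j * k ^ j)
      ≤⟨ *-monoʳ-≤ (suc k) (bern k j) ⟩
    suc k * suc k ^ suc j ∎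
    where
    expand : ∀ k j p → k * (k * p) + (2 + j) * (k * p) + suc j * p ≡ suc k * (k * p + suc j * p)
    expand = solve-∀
  2k^≤ : ∀ k → 2 * k ^ suc k ≤ suc k ^ suc k
  2k^≤ k = begin
    2 * k ^ suc k                  ≡⟨ two (k ^ suc k) ⟩
    k ^ suc k + k * k ^ k          ≤⟨ +-monoʳ-≤ (k ^ suc k) (*-monoˡ-≤ (k ^ k) (n≤1+n k)) ⟩
    k ^ suc k + suc k * k ^ k      ≤⟨ bern k k ⟩
    suc k ^ suc k                  ∎
    where
    two : ∀ p → 2 * p ≡ p + p
    two = solve-∀

density-bound : ∀ a b d f X P k D → D ≡ 8 * d * d * f → 8 * d * d * a ≤ b → X ≤ P * D → P ≤ k →
                a * X ≤ b * k * f
density-bound a b d f X P k _ refl 8d²a≤b X≤ P≤k = begin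
  a * X                      ≤⟨ *-monoʳ-≤ a X≤ ⟩
  a * (P * (8 * d * d * f))  ≡⟨ rearr a P d f ⟩
  8 * d * d * a * P * f      ≤⟨ *-monoˡ-≤ f (*-mono-≤ 8d²a≤b P≤k) ⟩
  b * k * f                  ∎
  where
  open ≤-Reasoning
  rearr : ∀ a P d f → a * (P * (8 * d * d * f)) ≡ 8 * d * d * a * P * f
  rearr = solve-∀


longStrip : ∀ e n P (w : List (Fin n)) → length w ≡ P + (2 + e) → defect (2 + e) w ≡ 0 →
            Σ (PureComplex n (2 + e)) λ C → StronglyConnected C ×
              ∃ λ F → ∃ λ G → F ∈ facets C × G ∈ facets C × (∀ k → Walk C F G k → P ≤ k)
longStrip e n P w₀ len₀ good
  with w , sep , len₀≤ , _ , all ← cover e (allFin n) w₀ (defect≡0⇒Separated e w₀ good)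
  = strip , stronglyConnected , W 0 , W L , facets⁺ z≤n , facets⁺ ≤-refl ,
    λ k p → ≤-trans P≤L (walk-length z≤n refl refl p)
  where
  L : ℕ
  L = length w ∸ (2 + e)
  P+d≤ : P + (2 + e) ≤ length w
  P+d≤ = subst (_≤ length w) len₀ len₀≤
  open Strip e w sep L (sym (m∸n+n≡m (≤-trans (m≤n+m (2 + e) P) P+d≤))) (λ v → all (∈-allFin v))
  P≤L : P ≤ L
  P≤L = subst (_≤ L) (m+n∸n≡m P (2 + e)) (∸-monoˡ-≤ (2 + e) P+d≤)

lowerBound : ∀ e a b n D → (D ≡ 8 * suc (suc e) * suc (suc e) * suc (suc e) !) →
             8 * suc (suc e) * suc (suc e) * a ≤ b →
             suc (suc (suc e)) * D + (4 * suc (suc e) + 8 * suc (suc e) * suc (suc e)) ≤ n →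
             LowerBound a b n (suc (suc e))
lowerBound e a b n D D≡ 8d²a≤b N≤n =
  let w , len , good = longGoodWord
      C , conn , F , G , F∈ , G∈ , long = longStrip e n pathLength w len good
  in C , conn , F , G , F∈ , G∈ , λ k p →
     density-bound a b (suc (suc e)) (suc (suc e) !) (n ^ suc e) pathLength k D D≡ 8d²a≤b
       pathLength-lower (long k p)
  where open LongWord (suc e) n D (s≤s z≤n) D≡ N≤n

-- Upper bound: induced paths and the words inside their facets.

χ-∩ : (p q : Subset n) (x : Fin n) → χ p x * χ q x ≡ χ (p ∩ q) x
χ-∩ (inside  ∷ p) (inside  ∷ q) zero    = refl
χ-∩ (inside  ∷ p) (outside ∷ q) zero    = refl
χ-∩ (outside ∷ p) (t       ∷ q) zero    = refl
χ-∩ (s       ∷ p) (t       ∷ q) (suc x) = χ-∩ p q x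

χ≤1 : (p : Subset n) (x : Fin n) → χ p x ≤ 1
χ≤1 (inside  ∷ p) zero    = ≤-refl
χ≤1 (outside ∷ p) zero    = z≤n
χ≤1 (s       ∷ p) (suc x) = χ≤1 p x

injWord≤1 : (p : Subset n) (h : List (Fin n)) → injWord p h ≤ 1
injWord≤1 p []      = ≤-refl
injWord≤1 p (x ∷ h) = *-mono-≤ (χ≤1 p x) (injWord≤1 (p - x) h)

injWord-∩ : (p q : Subset n) (h : List (Fin n)) → injWord p h * injWord q h ≡ injWord (p ∩ q) h
injWord-∩ p q []      = refl
injWord-∩ p q (x ∷ h) = begin
  χ p x * injWord (p - x) h * (χ q x * injWord (q - x) h)
    ≡⟨ interchange (χ p x) (injWord (p - x) h) (χ q x) (injWord (q - x) h) ⟩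
  χ p x * χ q x * (injWord (p - x) h * injWord (q - x) h)
    ≡⟨ cong₂ _*_ (χ-∩ p q x) (injWord-∩ (p - x) (q - x) h) ⟩
  χ (p ∩ q) x * injWord ((p - x) ∩ (q - x)) h
    ≡⟨ cong (λ r → χ (p ∩ q) x * injWord r h) (∩-distrib-minus p q x) ⟨
  χ (p ∩ q) x * injWord ((p ∩ q) - x) h ∎
  where
  open ≡-Reasoning
  interchange : ∀ a b c d → a * b * (c * d) ≡ a * c * (b * d)
  interchange = solve-∀

∣p∣<length⇒injWord≡0 : (p : Subset n) (h : List (Fin n)) → ∣ p ∣ < length h → injWord p h ≡ 0
∣p∣<length⇒injWord≡0 p (x ∷ h) ∣p∣< with x ∈? p
... | no  x∉p rewrite χ-∉ x∉p = refl
... | yes x∈p rewrite ∣p∣<length⇒injWord≡0 (p - x) h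
                        (subst (_≤ length h) (sym (∣p-x∣ x∈p)) (s≤s⁻¹ ∣p∣<)) = *-zeroʳ (χ p x)

⊆∧∣∣≥⇒≡ : {p q : Subset n} → p ⊆ q → ∣ q ∣ ≤ ∣ p ∣ → p ≡ q
⊆∧∣∣≥⇒≡ {p = p} p⊆q ∣q∣≤∣p∣ = ⊆-antisym p⊆q λ {x} x∈q → case x∈q (x ∈? p)
  where
  case : ∀ {x} → x ∈ₛ _ → Dec (x ∈ₛ p) → x ∈ₛ p
  case x∈q (yes x∈p) = x∈p
  case x∈q (no  x∉p) = contradiction ∣q∣≤∣p∣ (<⇒≱ (p⊂q⇒∣p∣<∣q∣ (p⊆q , _ , x∈q , x∉p)))

module _ {n k : ℕ} (C : PureComplex n (suc k)) where

  -- The list omits the first facet, so its length is the number of edges. Requiring fewer than k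
  -- common elements excludes chords and repeated facets alike.
  data InducedPath : Subset n → Subset n → List (Subset n) → Set where
    end  : ∀ {G} → G ∈ facets C → InducedPath G G []
    link : ∀ {F G H ps} → F ∈ facets C → Adjacent (suc k) F H →
           All (λ K → ∣ F ∩ K ∣ < k) ps → InducedPath H G ps → InducedPath F G (H ∷ ps)

  path⇒walk : ∀ {F G ps} → InducedPath F G ps → Walk C F G (length ps)
  path⇒walk (end _)                       = here
  path⇒walk (link _ adj _ p@(end H∈))      = step H∈ adj (path⇒walk p)
  path⇒walk (link _ adj _ p@(link H∈ _ _ _)) = step H∈ adj (path⇒walk p)

  path-source : ∀ {F G ps} → InducedPath F G ps → F ∈ facets C
  path-source (end F∈)        = F∈
  path-source (link F∈ _ _ _) = F∈

  -- The shortcut goes from F directly to the last facet of the path that meets F in at least a ridge.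
  prepend : ∀ {F G H ps} → F ∈ facets C → InducedPath H G ps →
            k ≤ ∣ F ∩ H ∣ ⊎ Any (λ K → k ≤ ∣ F ∩ K ∣) ps → ∃ (InducedPath F G)
  prepend {F} {H = H} {ps} F∈ p close with any? (λ K → k ≤? ∣ F ∩ K ∣) ps
  prepend F∈ (link _ _ _ p) close | yes (here close′)  = prepend F∈ p (inj₁ close′)
  prepend F∈ (link _ _ _ p) close | yes (there close′) = prepend F∈ p (inj₂ close′)
  prepend F∈ p (inj₂ close) | no ¬close = contradiction close ¬close
  prepend {F} {H = H} {ps} F∈ p (inj₁ k≤) | no ¬close with m≤n⇒m<n∨m≡n k≤
  ... | inj₂ k≡ = H ∷ ps , link F∈ (sym k≡) (All.map ≰⇒> (¬Any⇒All¬ ps ¬close)) p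
  -- More than k common elements means that F and H, both of size k + 1, coincide, so the path
  -- already starts at F.
  ... | inj₁ k< = ps , subst (λ F → InducedPath F _ ps) (sym F≡H) p
    where
    F≡H : F ≡ H
    F≡H = trans
      (sym (⊆∧∣∣≥⇒≡ (p∩q⊆p F H) (subst (_≤ ∣ F ∩ H ∣) (sym (facetSize C F∈)) k<)))
      (⊆∧∣∣≥⇒≡ (p∩q⊆q F H) (subst (_≤ ∣ F ∩ H ∣) (sym (facetSize C (path-source p))) k<))

  walk⇒path : ∀ {F G l} → F ∈ facets C → Walk C F G l → ∃ (InducedPath F G)
  walk⇒path F∈ here              = [] , end F∈
  walk⇒path F∈ (step H∈ adj p) =
    let ps , q = walk⇒path H∈ p in prepend F∈ q (inj₁ (≤-reflexive (sym adj)))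

  -- Ridges are counted with orderings, k! words each, so that the total is compared with n^k and
  -- not with a binomial coefficient.
  facetWords ridgeWords : Subset n → List (Subset n) → List (Fin n) → ℕ
  facetWords F []       h = injWord F h
  facetWords F (H ∷ ps) h = injWord F h + facetWords H ps h
  ridgeWords F []       h = 0
  ridgeWords F (H ∷ ps) h = injWord (F ∩ H) h + ridgeWords H ps h

  -- A repetition-free word of length k lies in no facet of an induced path, in a single one,
  -- or in two consecutive ones and then in their common ridge.
  facetWords≤ : ∀ {F G ps} → InducedPath F G ps → ∀ h → length h ≡ k →
                facetWords F ps h ≤ 1 + ridgeWords F ps h
  facetWords≤ {F} (end _) h eq = ≤-trans (injWord≤1 F h) (m≤m+n 1 0)
  facetWords≤ {F} (link {H = H} {ps} F∈ adj far p) h eq with injWord F h in F≡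
  ... | 0 = ≤-trans (facetWords≤ p h eq) (s≤s (m≤n+m _ (injWord (F ∩ H) h)))
  ... | suc (suc _) = contradiction (subst (_≤ 1) F≡ (injWord≤1 F h)) λ { (s≤s ()) }
  ... | 1 = s≤s (≤-trans (facetWords≤injWord H ps far)
                  (≤-trans (≤-reflexive (sym (F∩ H))) (m≤m+n _ (ridgeWords H ps h))))
    where
    F∩ : ∀ K → injWord (F ∩ K) h ≡ injWord K h
    F∩ K = trans (sym (injWord-∩ F K h)) (trans (cong (_* injWord K h) F≡) (*-identityˡ _))
    facetWords≤injWord : ∀ H ps → All (λ K → ∣ F ∩ K ∣ < k) ps → facetWords H ps h ≤ injWord H h
    facetWords≤injWord H []       []          = ≤-refl
    facetWords≤injWord H (K ∷ ps) (F∩K< ∷ far) = ≤-trans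
      (+-monoʳ-≤ (injWord H h) (≤-trans (facetWords≤injWord K ps far) (≤-reflexive K≡0)))
      (≤-reflexive (+-identityʳ _))
      where
      K≡0 : injWord K h ≡ 0
      K≡0 = trans (sym (F∩ K))
        (∣p∣<length⇒injWord≡0 (F ∩ K) h (subst (∣ F ∩ K ∣ <_) (sym eq) F∩K<))

  ∑-injWord-facet : ∀ {F} → F ∈ facets C → ∑ʷ k (injWord F) ≡ suc k !
  ∑-injWord-facet {F} F∈ =
    trans (∑ʷ-injWord k F) (trans (cong (λ s → ff s k) (facetSize C F∈)) (ff-!′ k))

  ∑-facetWords : ∀ {F G ps} → InducedPath F G ps → ∑ʷ k (facetWords F ps) ≡ suc (length ps) * suc k !
  ∑-facetWords (end F∈) = trans (∑-injWord-facet F∈) (sym (+-identityʳ (suc k !)))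
  ∑-facetWords {F} (link {H = H} {ps} F∈ _ _ p) =
    trans (∑ʷ-+ k (injWord F) (facetWords H ps)) (cong₂ _+_ (∑-injWord-facet F∈) (∑-facetWords p))

  ∑-ridgeWords : ∀ {F G ps} → InducedPath F G ps → ∑ʷ k (ridgeWords F ps) ≡ length ps * k !
  ∑-ridgeWords (end _) = trans (∑ʷ-const {n} k 0) (*-zeroʳ (n ^ k))
  ∑-ridgeWords {F} (link {H = H} {ps} _ adj _ p) = trans
    (∑ʷ-+ k (injWord (F ∩ H)) (ridgeWords H ps))
    (cong₂ _+_ (trans (∑ʷ-injWord k (F ∩ H)) (trans (cong (λ s → ff s k) adj) (ff-! k)))
               (∑-ridgeWords p))

  path-length : ∀ {F G ps} → InducedPath F G ps → length ps * (suc k !) * k ≤ suc k * n ^ k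
  path-length {F} {ps = ps} p = begin
    l * (suc k * k !) * k     ≡⟨ r₁ l k (k !) ⟩
    suc k * (l * k * k !)     ≤⟨ *-monoʳ-≤ (suc k) (+-cancelʳ-≤ (l * k !) _ _ count) ⟩
    suc k * n ^ k             ∎
    where
    open ≤-Reasoning
    l = length ps
    r₁ : ∀ l k f → l * (suc k * f) * k ≡ suc k * (l * k * f)
    r₁ = solve-∀
    r₂ : ∀ l k f → l * k * f + l * f ≡ l * (suc k * f)
    r₂ = solve-∀
    count : l * k * k ! + l * k ! ≤ n ^ k + l * k !
    count = begin
      l * k * k ! + l * k !              ≡⟨ r₂ l k (k !) ⟩
      -- Giving up one facet's (k + 1)! leaves l (k + 1)! = l k k! + l k!, and the last term cancels
      -- against the ridges.
      l * (suc k !)                      ≤⟨ m≤n+m _ (suc k !) ⟩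
      suc l * (suc k !)                  ≡⟨ ∑-facetWords p ⟨
      ∑ʷ k (facetWords F ps)             ≤⟨ ∑ʷ-mono k (facetWords≤ p) ⟩
      ∑ʷ k (λ h → 1 + ridgeWords F ps h) ≡⟨ ∑ʷ-+ k (λ _ → 1) (ridgeWords F ps) ⟩
      ∑ʷ {n} k (λ _ → 1) + ∑ʷ k (ridgeWords F ps)
        ≡⟨ cong₂ _+_ (trans (∑ʷ-const {n} k 1) (*-identityʳ (n ^ k))) (∑-ridgeWords p) ⟩
      n ^ k + l * k !                    ∎

upperBound : ∀ n k → UpperBound n (suc k)
upperBound n k C conn F∈ G∈ =
  let ps , p = walk⇒path C F∈ (proj₂ (conn F∈ G∈))
  in length ps , path⇒walk C p , path-length C p

theorem2 : (d : ℕ) → d ≥ 3 →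
    (∀ (a b k : ℕ) → b ≥ 1 → k ≥ 1 → BelowInvFourEdSq a b d k →
      ∃ λ N → ∀ n → n ≥ N → LowerBound a b n d)
    × (∃ λ N → ∀ n → n ≥ N → UpperBound n d)
theorem2 1 (s≤s ())
theorem2 (suc (suc e)) d≥3 =
  (λ a b k _ k≥1 below →
     -- `refl` sets D to 8 d² d!, and N is then read off from the hypothesis of `lowerBound`; it
     -- depends on d alone.
     _ , λ n n≥N → lowerBound e a b n _ refl (BelowInvFourEdSq⇒≤ a b (suc (suc e)) k k≥1 below) n≥N) ,
  (0 , λ n _ → upperBound n (suc e))
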